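{- Let $\langle\mathfrak{B},\mathsf{C}\rangle$ be a complete Boolean contact algebra satisfying (C4$^c$), and let $m\colon B\to B$ be the operator defined by letting $m(x)$ be the unique $y\in B$ such that $\mathsf{C}(x)=\mathsf{O}(y)$. Then $m$ is a completely additive modal possibility operator, i.e. $m(\mathbf{0})=\mathbf{0}$, $m(x+y)=m(x)+m(y)$ for all $x,y\in B$, and $m\left(\bigvee J\right)=\bigvee_{x\in J}m(x)$ for every $J\subseteq B$; moreover, for all $x,y\in B$: (1) $x\ll m(x)$, and so $x\leq m(x)$, i.e. $x+m(x)=m(x)$; (2) $m(x)\leq -y$ if and only if $m(y)\leq -x$; and this condition (for all $x,y$) is equivalent to: $m(-m(-x))\leq x$ for all $x$.
   Context: A Boolean contact algebra is a pair $\langle\mathfrak{B},\mathsf{C}\rangle$ where $\mathfrak{B}=\langle B,\cdot,+,-,\mathbf{0},\mathbf{1}\rangle$ is a Boolean algebra and $\mathsf{C}\subseteq B\times B$ satisfies, for all $x,y,z\in B$: (C0) not $\mathbf{0}\mathrel{\mathsf{C}}x$; (C1) if $x\le y$ and $x\ne\mathbf{0}$, then $x\mathrel{\mathsf{C}}y$; (C2) if $x\mathrel{\mathsf{C}}y$, then $y\mathrel{\mathsf{C}}x$; (C3) if $x\le y$ and $z\mathrel{\mathsf{C}}x$, then $z\mathrel{\mathsf{C}}y$; (C4) if $x\mathrel{\mathsf{C}}(y+z)$, then $x\mathrel{\mathsf{C}}y$ or $x\mathrel{\mathsf{C}}z$. It is complete if $\mathfrak{B}$ is a complete Boolean algebra.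 (C4$^c$): for every $x\in B$ and every $J\subseteq B$, if $x\mathrel{\mathsf{C}}\bigvee J$, then there is $y\in J$ with $x\mathrel{\mathsf{C}}y$. Notation: $\mathsf{C}(x)=\{y\in B\mid y\mathrel{\mathsf{C}}x\}$; $\mathsf{O}(x)=\{y\in B\mid y\cdot x\neq\mathbf{0}\}$; $x\ll y$ iff not $x\mathrel{\mathsf{C}}(-y)$. In a complete Boolean contact algebra satisfying (C4$^c$), for every $x$ there is exactly one $y$ with $\mathsf{C}(x)=\mathsf{O}(y)$, so $m$ is well defined. -}

module Defs where

open import Algebra.Core using (Op₁)
open import Algebra.Lattice.Bundles using (BooleanAlgebra)
import Algebra.Lattice.Properties.BooleanAlgebra as BooleanAlgebraProperties
open import Data.Product.Base using (∃-syntax; _×_)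
open import Data.Sum.Base using (_⊎_)
open import Level using (Level; _⊔_; suc)
open import Relation.Binary.Bundles using (Poset)
open import Relation.Binary.Core using (Rel)
import Relation.Nullary.Negation as Logic
open import Relation.Unary using (Pred; _∈_; _≐_)

-- Subsets of the carrier are predicates at level c ⊔ ℓ ⊔ r, so that every
-- subset first-order definable from _≈_ and _C_ is among them.  They are not
-- required to respect _≈_; closing a subset under _≈_ does not change its
-- upper bounds.

record CompleteBooleanContactAlgebra (c ℓ r : Level) : Set (suc (c ⊔ ℓ ⊔ r)) where
  infix 4 _C_ _≪_
  infix 9 ⋁_

  field
    booleanAlgebra : BooleanAlgebra c ℓ

  open BooleanAlgebra booleanAlgebra public

  -- x ≤ y is x ≈ x ∧ y.
  open Poset (BooleanAlgebraProperties.poset booleanAlgebra) public using (_≤_)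

  Subset : Set (suc (c ⊔ ℓ ⊔ r))
  Subset = Pred Carrier (c ⊔ ℓ ⊔ r)

  field
    ⋁_      : Subset → Carrier
    ⋁-upper : ∀ J {x} → x ∈ J → x ≤ ⋁ J
    ⋁-least : ∀ J z → (∀ {x} → x ∈ J → x ≤ z) → ⋁ J ≤ z

  -- That _C_ respects _≈_ follows from C2 and C3.
  field
    _C_ : Rel Carrier r
    C0  : ∀ x → Logic.¬ (⊥ C x)
    C1  : ∀ x y → x ≤ y → x ≉ ⊥ → x C y
    C2  : ∀ x y → x C y → y C x
    C3  : ∀ x y z → x ≤ y → z C x → z C y
    C4  : ∀ x y z → x C (y ∨ z) → x C y ⊎ x C z

  C4ᶜ : Set (suc (c ⊔ ℓ ⊔ r))
  C4ᶜ = ∀ x (J : Subset) → x C ⋁ J → ∃[ y ] (y ∈ J × x C y)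

  _≪_ : Rel Carrier r
  x ≪ y = Logic.¬ (x C (¬ y))

  C⟨_⟩ : Carrier → Pred Carrier r
  C⟨ x ⟩ y = y C x

  O⟨_⟩ : Carrier → Pred Carrier ℓ
  O⟨ x ⟩ y = y ∧ x ≉ ⊥

  -- { f x ∣ x ∈ J }, closed under _≈_.
  image : Op₁ Carrier → Subset → Subset
  image f J z = ∃[ x ] (x ∈ J × z ≈ f x)

  -- "m x is the unique y with C⟨ x ⟩ = O⟨ y ⟩", i.e. m x is a witness of
  -- ∃! _≈_ (λ y → C⟨ x ⟩ ≐ O⟨ y ⟩).  Under C4ᶜ and classical logic such an m
  -- exists: m x = ¬ ⋁ { z ∣ not z C x }.
  IsContactOperator : Op₁ Carrier → Set (c ⊔ ℓ ⊔ r)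
  IsContactOperator m =
    ∀ x → (C⟨ x ⟩ ≐ O⟨ m x ⟩) × (∀ {y} → C⟨ x ⟩ ≐ O⟨ y ⟩ → m x ≈ y)

{-# OPTIONS --safe #-}
module Submission where

-- The two-variable condition  m x ≤ ¬ y ⇔ m y ≤ ¬ x  is the symmetry of contact,
-- since m x ≤ ¬ y says that x and y are not in contact.  It makes m a lower
-- adjoint of x ↦ ¬ m (¬ x), and lower adjoints preserve all joins.
--
-- Equality on the carrier need not be decidable.  What replaces excluded middle
-- is that O⟨ y ⟩ depends only on the double negation of equality, so that the
-- uniqueness of m x makes m x ≈ y a ¬¬-stable proposition.

open import Defs
open import Algebra.Core using (Op₁)
open import Algebra.Lattice.Bundles using (BooleanAlgebra)
import Algebra.Lattice.Properties.BooleanAlgebra as BooleanAlgebraProperties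
open import Data.Product.Base using (_×_; _,_; proj₁; proj₂)
open import Function.Base using (_∘_)
open import Function.Bundles using (_⇔_; mk⇔; Equivalence)
open import Level using (Level)
open import Relation.Unary using (_≐_)
import Relation.Binary.Lattice as OrderTheoretic
import Relation.Binary.Lattice.Properties.JoinSemilattice as JoinSemilatticeProperties
import Relation.Binary.Reasoning.Setoid as SetoidReasoning
import Relation.Nullary.Negation.Core as Logic

private
  variable
    c ℓ r : Level

module BooleanOrder (𝔹 : BooleanAlgebra c ℓ) where
  open BooleanAlgebra 𝔹
  open BooleanAlgebraProperties 𝔹
  open OrderTheoretic.Lattice ∨-∧-orderTheoreticLattice public
    using (_≤_; x≤x∨y; y≤x∨y; ∨-least; x∧y≤x; x∧y≤y; antisym; joinSemilattice)
    renaming (refl to ≤-refl; trans to ≤-trans; reflexive to ≤-reflexive)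
  open JoinSemilatticeProperties joinSemilattice public using (x≤y⇒x∨y≈y)
  open SetoidReasoning setoid

  ⊥-least : ∀ x → ⊥ ≤ x
  ⊥-least x = sym (∧-zeroˡ x)

  ≤¬⇒disjoint : ∀ {x y} → x ≤ ¬ y → y ∧ x ≈ ⊥
  ≤¬⇒disjoint {x} {y} x≤¬y = begin
    y ∧ x          ≈⟨ ∧-congˡ x≤¬y ⟩
    y ∧ (x ∧ ¬ y)  ≈⟨ ∧-congˡ (∧-comm x (¬ y)) ⟩
    y ∧ (¬ y ∧ x)  ≈⟨ ∧-assoc y (¬ y) x ⟨
    (y ∧ ¬ y) ∧ x  ≈⟨ ∧-congʳ (∧-complementʳ y) ⟩
    ⊥ ∧ x          ≈⟨ ∧-zeroˡ x ⟩
    ⊥              ∎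

  disjoint⇒≤¬ : ∀ {x y} → y ∧ x ≈ ⊥ → x ≤ ¬ y
  disjoint⇒≤¬ {x} {y} y∧x≈⊥ = begin
    x                  ≈⟨ ∧-identityʳ x ⟨
    x ∧ ⊤              ≈⟨ ∧-congˡ (∨-complementʳ y) ⟨
    x ∧ (y ∨ ¬ y)      ≈⟨ ∧-distribˡ-∨ x y (¬ y) ⟩
    x ∧ y ∨ x ∧ ¬ y    ≈⟨ ∨-congʳ (trans (∧-comm x y) y∧x≈⊥) ⟩
    ⊥ ∨ x ∧ ¬ y        ≈⟨ ∨-identityˡ (x ∧ ¬ y) ⟩
    x ∧ ¬ y            ∎

  ≤¬-swap : ∀ {x y} → x ≤ ¬ y → y ≤ ¬ x
  ≤¬-swap {x} {y} x≤¬y = disjoint⇒≤¬ (trans (∧-comm x y) (≤¬⇒disjoint x≤¬y))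

  ≤⇒≤¬¬ : ∀ {x y} → x ≤ y → x ≤ ¬ ¬ y
  ≤⇒≤¬¬ x≤y = ≤-trans x≤y (≤-reflexive (sym (¬-involutive _)))

  ≤¬¬⇒≤ : ∀ {x y} → x ≤ ¬ ¬ y → x ≤ y
  ≤¬¬⇒≤ x≤¬¬y = ≤-trans x≤¬¬y (≤-reflexive (¬-involutive _))

  -- Self-conjugacy in the sense of Jónsson and Tarski. One implication suffices because `x` and `y`
  -- are arbitrary.
  module SelfConjugate (m : Op₁ Carrier) (conj : ∀ {x y} → m x ≤ ¬ y → m y ≤ ¬ x) where

    m≤⇒≤¬m¬ : ∀ {x y} → m x ≤ y → x ≤ ¬ m (¬ y)
    m≤⇒≤¬m¬ mx≤y = ≤¬-swap (conj (≤⇒≤¬¬ mx≤y))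

    ≤¬m¬⇒m≤ : ∀ {x y} → x ≤ ¬ m (¬ y) → m x ≤ y
    ≤¬m¬⇒m≤ x≤¬m¬y = ≤¬¬⇒≤ (conj (≤¬-swap x≤¬m¬y))

    m-mono : ∀ {x y} → x ≤ y → m x ≤ m y
    m-mono x≤y = ≤¬m¬⇒m≤ (≤-trans x≤y (m≤⇒≤¬m¬ ≤-refl))

    m-⊥ : m ⊥ ≈ ⊥
    m-⊥ = antisym (≤¬m¬⇒m≤ (⊥-least _)) (⊥-least _)

    m-∨ : ∀ x y → m (x ∨ y) ≈ m x ∨ m y
    m-∨ x y = antisym
      (≤¬m¬⇒m≤ (∨-least (m≤⇒≤¬m¬ (x≤x∨y (m x) (m y))) (m≤⇒≤¬m¬ (y≤x∨y (m x) (m y)))))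
      (∨-least (m-mono (x≤x∨y x y)) (m-mono (y≤x∨y x y)))

    -- The counit of the adjunction.
    m¬m¬≤ : ∀ x → m (¬ m (¬ x)) ≤ x
    m¬m¬≤ x = ≤¬m¬⇒m≤ ≤-refl

module Contact (𝔅 : CompleteBooleanContactAlgebra c ℓ r) where
  open CompleteBooleanContactAlgebra 𝔅
  open BooleanOrder booleanAlgebra hiding (_≤_)

  -- If `x ≤ y` fails, then `¬ y ∧ x` is nonzero, so C1 puts it in contact with `x`, and C3 enlarges
  -- it to `¬ y`.
  ≪⇒¬¬≤ : ∀ {x y} → x ≪ y → Logic.¬ Logic.¬ (x ≤ y)
  ≪⇒¬¬≤ {x} {y} x≪y x≰y = x≪y (C3 _ _ x (x∧y≤x (¬ y) x) (C2 _ x (C1 _ x (x∧y≤y (¬ y) x)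
    (x≰y ∘ ≤¬¬⇒≤ ∘ disjoint⇒≤¬))))

  module ContactOperator (m : Op₁ Carrier) (isContactOperator : IsContactOperator m) where

    C⇒O : ∀ {x y} → y C x → y ∧ m x ≉ ⊥
    C⇒O {x} = proj₁ (proj₁ (isContactOperator x))

    O⇒C : ∀ {x y} → y ∧ m x ≉ ⊥ → y C x
    O⇒C {x} = proj₂ (proj₁ (isContactOperator x))

    m-unique : ∀ {x y} → C⟨ x ⟩ ≐ O⟨ y ⟩ → m x ≈ y
    m-unique {x} = proj₂ (isContactOperator x)

    m≈-stable : ∀ {x y} → Logic.Stable (m x ≈ y)
    m≈-stable ¬¬mx≈y = m-unique
      ( (λ zCx z∧y≈⊥ → ¬¬mx≈y λ mx≈y → C⇒O zCx (trans (∧-congˡ mx≈y) z∧y≈⊥))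
      , (λ z∧y≉⊥ → O⇒C λ z∧mx≈⊥ → ¬¬mx≈y λ mx≈y → z∧y≉⊥ (trans (∧-congˡ (sym mx≈y)) z∧mx≈⊥))
      )

    -- The order unfolds to `m x ≈ m x ∧ ¬ y`, an equation with `m x` on the left, so `m≈-stable`
    -- permits a proof by contradiction.
    ¬C⇒m≤¬ : ∀ {x y} → Logic.¬ (y C x) → m x ≤ ¬ y
    ¬C⇒m≤¬ ¬yCx = m≈-stable (λ mx≰¬y → ¬yCx (O⇒C (mx≰¬y ∘ disjoint⇒≤¬)))

    m≤¬⇒¬C : ∀ {x y} → m x ≤ ¬ y → Logic.¬ (y C x)
    m≤¬⇒¬C mx≤¬y yCx = C⇒O yCx (≤¬⇒disjoint mx≤¬y)

    conj : ∀ {x y} → m x ≤ ¬ y → m y ≤ ¬ x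
    conj {x} {y} mx≤¬y = ¬C⇒m≤¬ (m≤¬⇒¬C mx≤¬y ∘ C2 x y)

    open SelfConjugate m conj public

    m-⋁ : ∀ J → m (⋁ J) ≈ ⋁ (image m J)
    m-⋁ J = antisym
      -- Transposing `m` to the right of the order leaves a bound on `⋁ J`, which is checked on each
      -- member of `J` and transposed back.
      (≤¬m¬⇒m≤ (⋁-least J _ λ {x} x∈J → m≤⇒≤¬m¬ (⋁-upper (image m J) (x , x∈J , refl))))
      (⋁-least (image m J) _ λ (x , x∈J , z≈mx) →
        ≤-trans (≤-reflexive z≈mx) (m-mono (⋁-upper J x∈J)))

    ≪-m : ∀ x → x ≪ m x
    ≪-m x = m≤¬⇒¬C (≤⇒≤¬¬ ≤-refl) ∘ C2 x (¬ m x)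

    -- `x ≤ m x` unfolds to an equation for `x`, to which `m≈-stable` does not apply directly. The
    -- join form, read from right to left, is an equation for `m x`.
    ∨-m : ∀ x → x ∨ m x ≈ m x
    ∨-m x = sym (m≈-stable (Logic.¬¬-map (sym ∘ x≤y⇒x∨y≈y) (≪⇒¬¬≤ (≪-m x))))

    ≤-m : ∀ x → x ≤ m x
    ≤-m x = ≤-trans (x≤x∨y x (m x)) (≤-reflexive (∨-m x))

lemma6p4 : {c ℓ r : Level} (𝔅 : CompleteBooleanContactAlgebra c ℓ r) →
    let open CompleteBooleanContactAlgebra 𝔅 in
    C4ᶜ →
    (m : Op₁ Carrier) → IsContactOperator m →
    (m ⊥ ≈ ⊥)
    × (∀ x y → m (x ∨ y) ≈ m x ∨ m y)
    × (∀ (J : Subset) → m (⋁ J) ≈ ⋁ (image m J))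
    × (∀ x → x ≪ m x)
    × (∀ x → x ≤ m x)
    × (∀ x → x ∨ m x ≈ m x)
    × (∀ x y → (m x ≤ ¬ y) ⇔ (m y ≤ ¬ x))
    × ((∀ x y → (m x ≤ ¬ y) ⇔ (m y ≤ ¬ x)) ⇔ (∀ x → m (¬ (m (¬ x))) ≤ x))
lemma6p4 𝔅 _ m isContactOperator =
    m-⊥ , m-∨ , m-⋁ , ≪-m , ≤-m , ∨-m
  , (λ x y → mk⇔ conj conj)
  -- `SelfConjugate` is instantiated here with the assumed condition, not with the `conj` that
  -- contact provides.
  , mk⇔ (λ conjugate → SelfConjugate.m¬m¬≤ m (Equivalence.to (conjugate _ _)))
        (λ m¬m¬≤x x y → mk⇔ (m¬m¬≤⇒conj m¬m¬≤x) (m¬m¬≤⇒conj m¬m¬≤x))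
  where
  open CompleteBooleanContactAlgebra 𝔅
  open BooleanOrder booleanAlgebra hiding (_≤_)
  open Contact 𝔅
  open ContactOperator m isContactOperator

  m¬m¬≤⇒conj : (∀ x → m (¬ m (¬ x)) ≤ x) → ∀ {x y} → m x ≤ ¬ y → m y ≤ ¬ x
  m¬m¬≤⇒conj m¬m¬≤x {x} mx≤¬y =
    -- From `m (¬ ¬ x) ≤ ¬ y` follows `y ≤ ¬ m (¬ ¬ x)`. Applying `m` gives `m y ≤ m (¬ m (¬ ¬ x))`,
    -- and the hypothesis at `¬ x` bounds the right side.
    ≤-trans (m-mono (≤¬-swap (≤-trans (m-mono (≤-reflexive (¬-involutive x))) mx≤¬y))) (m¬m¬≤x (¬ x))
    where open BooleanAlgebraProperties booleanAlgebra using (¬-involutive)
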